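{- Let $Q$ be a function from a recursive subset of $\mathbb{N}^3$ to $\mathbb{N}$ such that $Q(n,k,s)\in B^n$ whenever defined, and let $r>1$. Then there exists a coloring function $c:\mathbb{N}\rightarrow\{0,\dots,r-1\}$, uniformly recursive in $Q$, such that for any $w\in\mathbb{Z}^+$ and any $n<\lambda(w)$, if $Q(n,\lambda(w),\mu(w))$ is defined then $c(w+Q(n,\lambda(w),\mu(w)))\equiv c(w)+1 \pmod r$.
   Context: For $x=\sum_{i=0}^{k}2^{n_i}\in\mathbb{Z}^+$ with $n_0<\dots<n_k$, set $\mu(x)=n_k$ and $\lambda(x)=n_0$. For $n\in\mathbb{N}$, $B^n=\{x\in\mathbb{Z}^+:\mu(x)=n\}$. -}

module Defs where

open import Data.Nat.Base using (ℕ; zero; suc; _<_; _%_; _≡ᵇ_; ⌊_/2⌋)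
open import Data.Nat.Logarithm using (⌊log₂_⌋)
open import Data.Bool.Base using (if_then_else_)
open import Data.Product using (_×_)
open import Relation.Binary.PropositionalEquality using (_≡_)

μ : ℕ → ℕ
μ x = ⌊log₂ x ⌋

-- λ(x) : exponent of the lowest power of 2 in the binary expansion of x (x > 0),
-- i.e. the number of trailing zero bits. Computed with fuel x (λ(x) < x suffices).
λ-go : ℕ → ℕ → ℕ
λ-go zero    x = 0
λ-go (suc f) x =
  if x ≡ᵇ 0 then 0
  else if x % 2 ≡ᵇ 0 then suc (λ-go f ⌊ x /2⌋)
  else 0

λ₂ : ℕ → ℕ
λ₂ x = λ-go x x

B : ℕ → ℕ → Set
B n x = (0 < x) × (μ x ≡ n)

module Submission where

-- The colouring is c x = Φ_{μ x}(x) mod r, for integer potentials Φ_s that increase by 1 along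
-- every step w ↦ w + Q(n, λ w, s) (such a step does not change μ).  Φ_s is defined by
-- well-founded recursion: when a set bit K of x other than the lowest one cuts x into its part p
-- from bit K up and its part y below K, where y is the label q = Q(μ y, K, s) with the bits below
-- λ y cleared, then Φ x = Φ p + 1 − Φ q + Φ y; for a step x = w + q this is Φ w + 1.  The point is
-- that the value does not depend on the cut: if x is cut at K₁ < K₂ and z is the block of x
-- between them, then p₁ = p₂ + z is cut at K₂ with label q₂ and y₂ = z + y₁ at K₁ with label q₁,
-- so by induction both values equal Φ p₂ + 1 − Φ q₂ + (Φ z + 1 − Φ q₁ + Φ y₁).

open import Defs
open import Data.Nat.Base
open import Data.Nat.Properties
open import Data.Nat.DivMod
open import Data.Nat.Divisibility using (_∣_; divides)
open import Data.Nat.Induction using (<-rec; <-wellFounded)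
open import Data.Nat.Logarithm using (⌊log₂⌋-mono-≤; ⌊log₂⌊n/2⌋⌋≡⌊log₂n⌋∸1; ⌊log₂[2^n]⌋≡n)
open import Data.Integer.Base as ℤ using (ℤ; -[1+_]; 0ℤ; 1ℤ; _%ℕ_)
open import Data.Integer.DivMod using (n%ℕd<d)
open import Data.Maybe.Base using (Maybe; just; nothing)
open import Data.Maybe.Properties using (just-injective)
open import Data.Fin.Base using (Fin; toℕ; fromℕ<)
open import Data.Fin.Properties using (toℕ-fromℕ<)
open import Data.Product using (Σ; ∃; ∃₂; _×_; _,_; proj₁; proj₂)
open import Data.Sum using (inj₁; inj₂)
open import Data.Empty using (⊥-elim)
open import Function.Base using (case_of_)
open import Induction.WellFounded using (module FixPoint)
open import Relation.Binary.Definitions using (tri<; tri≈; tri>)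
open import Relation.Binary.PropositionalEquality
open import Relation.Nullary using (Dec; yes; no)
open import Relation.Nullary.Decidable using (map′; _×-dec_)
open import Data.Nat.Tactic.RingSolver using (solve-∀)
import Data.Integer.Tactic.RingSolver as ℤ-Solver

/-%-unique : ∀ {x a r M} .{{_ : NonZero M}} → x ≡ r + a * M → r < M → x / M ≡ a × x % M ≡ r
/-%-unique {a = a} {r} {M} refl r<M = quotient , remainder
  where
  remainder : (r + a * M) % M ≡ r
  remainder = trans ([m+kn]%n≡m%n r a M) (m<n⇒m%n≡m r<M)
  remainders< : r % M + a * M % M < M
  remainders< = subst (_< M) (sym (trans (cong₂ _+_ (m<n⇒m%n≡m r<M) (m*n%n≡0 a M)) (+-identityʳ r))) r<M
  quotient : (r + a * M) / M ≡ a
  quotient = trans (+-distrib-/ r (a * M) remainders<) (cong₂ _+_ (m<n⇒m/n≡0 r<M) (m*n/n≡m a M))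

*+≤-of-∣ : ∀ k {m n} → m ∣ n → k * m < n → k * m + m ≤ n
*+≤-of-∣ k {m} (divides t refl) k*m<t*m =
  subst (_≤ t * m) (+-comm m (k * m)) (*-monoˡ-≤ m (*-cancelʳ-< m k t k*m<t*m))

2^-cancel-< : ∀ {j K} → 2 ^ j < 2 ^ K → j < K
2^-cancel-< {j} {K} 2^j<2^K with j <? K
... | yes j<K = j<K
... | no j≮K = ⊥-elim (<⇒≱ 2^j<2^K (^-monoʳ-≤ 2 (≮⇒≥ j≮K)))

2^-∣ : ∀ {j K} → j ≤ K → 2 ^ j ∣ 2 ^ K
2^-∣ {j} {K} j≤K with d , refl ← m≤n⇒∃[o]m+o≡n j≤K =
  divides (2 ^ d) (trans (^-distribˡ-+-* 2 j d) (*-comm (2 ^ j) (2 ^ d)))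

n<2^n : ∀ n → n < 2 ^ n
n<2^n zero    = z<s
n<2^n (suc n) = ≤-<-trans (n<2^n n) (^-monoʳ-< 2 (s≤s (s≤s z≤n)) (n<1+n n))

2^-split : ∀ {j K} → j < K → ∃ λ d → 2 ^ K ≡ 2 ^ d * 2 * 2 ^ j
2^-split {j} {K} j<K with d , refl ← m≤n⇒∃[o]m+o≡n j<K =
  d , trans (^-distribˡ-+-* 2 (suc j) d) (reorder (2 ^ j) (2 ^ d))
  where
  reorder : ∀ P D → 2 * P * D ≡ D * 2 * P
  reorder = solve-∀

*2^[1+j] : ∀ u j → u * 2 ^ suc j ≡ u * 2 ^ j * 2
*2^[1+j] u j = shift u (2 ^ j)
  where
  shift : ∀ u P → u * (2 * P) ≡ u * P * 2
  shift = solve-∀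

-- Residues of integers

[1+m%d]%d≡[1+m]%d : ∀ m d .{{_ : NonZero d}} → suc (m % d) % d ≡ suc m % d
[1+m%d]%d≡[1+m]%d m d = begin
  (1 + m % d) % d         ≡⟨ %-distribˡ-+ 1 (m % d) d ⟩
  (1 % d + m % d % d) % d ≡⟨ cong (λ t → (1 % d + t) % d) (m%n%n≡m%n m d) ⟩
  (1 % d + m % d) % d     ≡⟨ %-distribˡ-+ 1 m d ⟨
  (1 + m) % d             ∎
  where open ≡-Reasoning

-- (d ∸ a % d) % d is the residue of -a modulo d.
[d∸a%d]%d≡[1+[d∸[1+a]%d]%d]%d : ∀ a d .{{_ : NonZero d}} →
                               (d ∸ a % d) % d ≡ suc ((d ∸ suc a % d) % d) % d
[d∸a%d]%d≡[1+[d∸[1+a]%d]%d]%d a d@(suc _) with m≤n⇒m<n∨m≡n (m%n<n a d)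
... | inj₁ 1+t<d = begin
  (d ∸ t) % d                 ≡⟨ cong (_% d) (+-∸-assoc 1 (<⇒≤ 1+t<d)) ⟩
  suc (d ∸ suc t) % d         ≡⟨ cong (λ v → suc v % d) (m<n⇒m%n≡m (∸-monoʳ-< z<s (<⇒≤ 1+t<d))) ⟨
  suc ((d ∸ suc t) % d) % d   ≡⟨ cong (λ v → suc ((d ∸ v) % d) % d) 1+t≡[1+a]%d ⟩
  suc ((d ∸ suc a % d) % d) % d ∎
  where
  open ≡-Reasoning
  t = a % d
  1+t≡[1+a]%d : suc t ≡ suc a % d
  1+t≡[1+a]%d = trans (sym (m<n⇒m%n≡m 1+t<d)) ([1+m%d]%d≡[1+m]%d a d)
... | inj₂ 1+t≡d = begin
  (d ∸ t) % d                   ≡⟨ cong (λ v → (v ∸ t) % d) 1+t≡d ⟨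
  (suc t ∸ t) % d               ≡⟨ cong (_% d) (m+n∸n≡m 1 t) ⟩
  1 % d                         ≡⟨ cong (λ v → suc v % d) (n%n≡0 d) ⟨
  suc (d % d) % d               ≡⟨ cong (λ v → suc ((d ∸ v) % d) % d) [1+a]%d≡0 ⟨
  suc ((d ∸ suc a % d) % d) % d ∎
  where
  open ≡-Reasoning
  t = a % d
  [1+a]%d≡0 : suc a % d ≡ 0
  [1+a]%d≡0 = trans (sym ([1+m%d]%d≡[1+m]%d a d)) (trans (cong (_% d) 1+t≡d) (n%n≡0 d))

-[1+n]%ℕd : ∀ n d .{{_ : NonZero d}} → -[1+ n ] %ℕ d ≡ (d ∸ suc n % d) % d
-[1+n]%ℕd n d with suc n % d in eq
... | zero  = sym (n%n≡0 d)
... | suc t = sym (m<n⇒m%n≡m (∸-monoʳ-< z<s (subst (_≤ d) eq (m%n≤n (suc n) d))))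

-[1+n]+1%ℕd : ∀ n d .{{_ : NonZero d}} → (-[1+ n ] ℤ.+ 1ℤ) %ℕ d ≡ (d ∸ n % d) % d
-[1+n]+1%ℕd zero    d@(suc _) = sym (n%n≡0 d)
-[1+n]+1%ℕd (suc n) d         = -[1+n]%ℕd n d

[i+1]%ℕd : ∀ i d .{{_ : NonZero d}} → (i ℤ.+ 1ℤ) %ℕ d ≡ (i %ℕ d + 1) % d
[i+1]%ℕd (ℤ.+ n) d = begin
  (n + 1) % d         ≡⟨ cong (_% d) (+-comm n 1) ⟩
  suc n % d           ≡⟨ [1+m%d]%d≡[1+m]%d n d ⟨
  suc (n % d) % d     ≡⟨ cong (_% d) (+-comm 1 (n % d)) ⟩
  (n % d + 1) % d     ∎
  where open ≡-Reasoning
[i+1]%ℕd -[1+ n ] d = begin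
  (-[1+ n ] ℤ.+ 1ℤ) %ℕ d              ≡⟨ -[1+n]+1%ℕd n d ⟩
  (d ∸ n % d) % d                    ≡⟨ [d∸a%d]%d≡[1+[d∸[1+a]%d]%d]%d n d ⟩
  suc ((d ∸ suc n % d) % d) % d      ≡⟨ cong (λ v → suc v % d) (-[1+n]%ℕd n d) ⟨
  suc (-[1+ n ] %ℕ d) % d            ≡⟨ cong (_% d) (+-comm 1 _) ⟩
  (-[1+ n ] %ℕ d + 1) % d            ∎
  where open ≡-Reasoning

-- Cutting a binary expansion at bit K

high low highPart : ℕ → ℕ → ℕ
high x K = _/_ x (2 ^ K) {{m^n≢0 2 K}}
low  x K = _%_ x (2 ^ K) {{m^n≢0 2 K}}
highPart x K = high x K * 2 ^ K

low+highPart : ∀ x K → x ≡ low x K + highPart x K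
low+highPart x K = m≡m%n+[m/n]*n x (2 ^ K) {{m^n≢0 2 K}}

low<2^ : ∀ x K → low x K < 2 ^ K
low<2^ x K = m%n<n x (2 ^ K) {{m^n≢0 2 K}}

high-low-unique : ∀ {x a r} K → x ≡ r + a * 2 ^ K → r < 2 ^ K → high x K ≡ a × low x K ≡ r
high-low-unique K = /-%-unique {{m^n≢0 2 K}}

odd⇒pos : ∀ u → u % 2 ≡ 1 → 0 < u
odd⇒pos (suc _) _ = z<s

odd*2^-pos : ∀ u j → u % 2 ≡ 1 → 0 < u * 2 ^ j
odd*2^-pos u j u-odd = *-mono-< (odd⇒pos u u-odd) (m^n>0 2 j)

⌊n*2/2⌋≡n : ∀ n → ⌊ n * 2 /2⌋ ≡ n
⌊n*2/2⌋≡n n = sym (trans (n≡⌊n+n/2⌋ n) (cong ⌊_/2⌋ n+n≡n*2))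
  where
  n+n≡n*2 : n + n ≡ n * 2
  n+n≡n*2 = trans (cong (n +_) (sym (+-identityʳ n))) (*-comm 2 n)

λ-go-odd : ∀ f u → u % 2 ≡ 1 → λ-go (suc f) u ≡ 0
λ-go-odd f (suc u) u-odd rewrite u-odd = refl

λ-go-even : ∀ f x → 0 < x → x % 2 ≡ 0 → λ-go (suc f) x ≡ suc (λ-go f ⌊ x /2⌋)
λ-go-even f (suc x) _ x-even rewrite x-even = refl

λ-go-odd*2^ : ∀ f u j → u % 2 ≡ 1 → j < f → λ-go f (u * 2 ^ j) ≡ j
λ-go-odd*2^ (suc f) u zero    u-odd _ = trans (cong (λ-go (suc f)) (*-identityʳ u)) (λ-go-odd f u u-odd)
λ-go-odd*2^ (suc f) u (suc j) u-odd (s≤s j<f) = begin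
  λ-go (suc f) (u * 2 ^ suc j)   ≡⟨ cong (λ-go (suc f)) (*2^[1+j] u j) ⟩
  λ-go (suc f) (u * 2 ^ j * 2)   ≡⟨ λ-go-even f _ (subst (0 <_) (*2^[1+j] u j) (odd*2^-pos u (suc j) u-odd))
                                                  (m*n%n≡0 (u * 2 ^ j) 2) ⟩
  suc (λ-go f ⌊ u * 2 ^ j * 2 /2⌋) ≡⟨ cong (λ v → suc (λ-go f v)) (⌊n*2/2⌋≡n (u * 2 ^ j)) ⟩
  suc (λ-go f (u * 2 ^ j))       ≡⟨ cong suc (λ-go-odd*2^ f u j u-odd j<f) ⟩
  suc j                          ∎
  where open ≡-Reasoning

λ₂-odd*2^ : ∀ u j → u % 2 ≡ 1 → λ₂ (u * 2 ^ j) ≡ j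
λ₂-odd*2^ u j u-odd =
  λ-go-odd*2^ _ u j u-odd (<-≤-trans (n<2^n j) (m≤n*m (2 ^ j) u {{>-nonZero (odd⇒pos u u-odd)}}))

odd*2^-decomposition : ∀ x → 0 < x → ∃₂ λ u j → u % 2 ≡ 1 × x ≡ u * 2 ^ j
odd*2^-decomposition = <-rec _ decompose
  where
  decompose : ∀ x → (∀ {y} → y < x → 0 < y → ∃₂ λ u j → u % 2 ≡ 1 × y ≡ u * 2 ^ j)
            → 0 < x → ∃₂ λ u j → u % 2 ≡ 1 × x ≡ u * 2 ^ j
  decompose x rec x>0 with x % 2 in parity
  ... | 1 = x , 0 , parity , sym (*-identityʳ x)
  ... | suc (suc _) = ⊥-elim (<⇒≱ (m%n<n x 2) (subst (2 ≤_) (sym parity) (s≤s (s≤s z≤n))))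
  ... | 0 = double (rec half<x half>0)
    where
    open ≡-Reasoning
    x≡half*2 : x ≡ x / 2 * 2
    x≡half*2 = trans (m≡m%n+[m/n]*n x 2) (cong (_+ x / 2 * 2) parity)
    half>0 : 0 < x / 2
    half>0 = *-cancelʳ-< 2 0 (x / 2) (subst (0 <_) x≡half*2 x>0)
    half<x : x / 2 < x
    half<x = subst (x / 2 <_) (sym x≡half*2) (m<m*n (x / 2) 2 {{>-nonZero half>0}} (s≤s (s≤s z≤n)))
    double : (∃₂ λ u j → u % 2 ≡ 1 × x / 2 ≡ u * 2 ^ j) → ∃₂ λ u j → u % 2 ≡ 1 × x ≡ u * 2 ^ j
    double (u , j , u-odd , half≡) = u , suc j , u-odd , (begin
      x             ≡⟨ x≡half*2 ⟩
      x / 2 * 2     ≡⟨ cong (_* 2) half≡ ⟩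
      u * 2 ^ j * 2 ≡⟨ *2^[1+j] u j ⟨
      u * 2 ^ suc j ∎)

λ₂-spec : ∀ {x} → 0 < x → ∃ λ u → u % 2 ≡ 1 × x ≡ u * 2 ^ λ₂ x
λ₂-spec {x} x>0 with u , j , u-odd , refl ← odd*2^-decomposition x x>0 =
  u , u-odd , cong (λ k → u * 2 ^ k) (sym (λ₂-odd*2^ u j u-odd))

<2^K⇒λ₂<K : ∀ c K → 0 < c → c < 2 ^ K → λ₂ c < K
<2^K⇒λ₂<K c K c>0 c<2^K with u , u-odd , c≡ ← λ₂-spec c>0 =
  2^-cancel-< (≤-<-trans (subst (2 ^ λ₂ c ≤_) (sym c≡) (m≤n*m _ u {{>-nonZero (odd⇒pos u u-odd)}})) c<2^K)

λ₂-+-* : ∀ c K m → 0 < c → c < 2 ^ K → λ₂ (c + m * 2 ^ K) ≡ λ₂ c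
λ₂-+-* c K m c>0 c<2^K
  with u , u-odd , c≡ ← λ₂-spec c>0 | d , 2^K≡ ← 2^-split (<2^K⇒λ₂<K c K c>0 c<2^K) = begin
  λ₂ (c + m * 2 ^ K)               ≡⟨ cong₂ (λ a b → λ₂ (a + m * b)) c≡ 2^K≡ ⟩
  λ₂ (u * P + m * (2 ^ d * 2 * P)) ≡⟨ cong λ₂ (factor u P m (2 ^ d)) ⟩
  λ₂ ((u + m * 2 ^ d * 2) * P)     ≡⟨ λ₂-odd*2^ (u + m * 2 ^ d * 2) (λ₂ c) u+even-odd ⟩
  λ₂ c                             ∎
  where
  open ≡-Reasoning
  P = 2 ^ λ₂ c
  u+even-odd : (u + m * 2 ^ d * 2) % 2 ≡ 1
  u+even-odd = trans ([m+kn]%n≡m%n u (m * 2 ^ d) 2) u-odd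
  factor : ∀ u P m D → u * P + m * (D * 2 * P) ≡ (u + m * D * 2) * P
  factor = solve-∀

+2^λ₂≤2^ : ∀ c K → 0 < c → c < 2 ^ K → c + 2 ^ λ₂ c ≤ 2 ^ K
+2^λ₂≤2^ c K c>0 c<2^K with u , u-odd , c≡ ← λ₂-spec c>0 =
  subst (λ v → v + 2 ^ λ₂ c ≤ _) (sym c≡)
    (*+≤-of-∣ u (2^-∣ (<⇒≤ (<2^K⇒λ₂<K c K c>0 c<2^K))) (subst (_< _) c≡ c<2^K))

m<n+n⇒⌊m/2⌋<n : ∀ x y → x < y + y → ⌊ x /2⌋ < y
m<n+n⇒⌊m/2⌋<n zero          (suc y) _  = z<s
m<n+n⇒⌊m/2⌋<n (suc zero)    (suc y) _  = z<s
m<n+n⇒⌊m/2⌋<n (suc (suc x)) (suc y) lt =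
  s<s (m<n+n⇒⌊m/2⌋<n x y (s<s⁻¹ (s<s⁻¹ (subst (suc (suc x) <_) (+-suc (suc y) y) lt))))

<2^[1+m]⇒μ≤m : ∀ m x → x < 2 ^ suc m → μ x ≤ m
<2^[1+m]⇒μ≤m zero    zero          _ = z≤n
<2^[1+m]⇒μ≤m zero    (suc zero)    _ = z≤n
<2^[1+m]⇒μ≤m zero    (suc (suc x)) (s≤s (s≤s ()))
<2^[1+m]⇒μ≤m (suc m) x x<2^ = begin
  μ x                ≤⟨ m≤n+m∸n (μ x) 1 ⟩
  1 + (μ x ∸ 1)      ≡⟨ cong suc (⌊log₂⌊n/2⌋⌋≡⌊log₂n⌋∸1 x) ⟨
  1 + μ ⌊ x /2⌋      ≤⟨ s≤s (<2^[1+m]⇒μ≤m m ⌊ x /2⌋ (m<n+n⇒⌊m/2⌋<n x (2 ^ suc m) x<2^+2^)) ⟩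
  suc m              ∎
  where
  open ≤-Reasoning
  x<2^+2^ : x < 2 ^ suc m + 2 ^ suc m
  x<2^+2^ = subst (x <_) (cong (2 ^ suc m +_) (+-identityʳ _)) x<2^

2^m≤⇒m≤μ : ∀ {m x} → 2 ^ m ≤ x → m ≤ μ x
2^m≤⇒m≤μ {m} 2^m≤x = subst (_≤ _) (⌊log₂[2^n]⌋≡n m) (⌊log₂⌋-mono-≤ 2^m≤x)

2^μ≤ : ∀ {x} → 0 < x → 2 ^ μ x ≤ x
2^μ≤ {x} x>0 = ≮⇒≥ (not-below (μ x) refl)
  where
  not-below : ∀ m → μ x ≡ m → x ≮ 2 ^ m
  not-below zero    _   x<1  = <⇒≱ x<1 x>0
  not-below (suc m) μx≡ x<2^ = 1+n≰n (subst (_≤ m) μx≡ (<2^[1+m]⇒μ≤m m x x<2^))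

<2^[1+μ] : ∀ x → x < 2 ^ suc (μ x)
<2^[1+μ] x = ≰⇒> λ 2^≤x → 1+n≰n (2^m≤⇒m≤μ 2^≤x)

μ-unique : ∀ {m x} → 2 ^ m ≤ x → x < 2 ^ suc m → μ x ≡ m
μ-unique {m} {x} 2^m≤x x<2^ = ≤-antisym (<2^[1+m]⇒μ≤m m x x<2^) (2^m≤⇒m≤μ 2^m≤x)

μ-+-* : ∀ b K c → 0 < b → c < 2 ^ K → μ (c + b * 2 ^ K) ≡ μ (b * 2 ^ K)
μ-+-* b K c b>0 c<2^K = μ-unique (≤-trans (2^μ≤ y>0) (m≤n+m y c)) (begin-strict
  c + y        <⟨ +-monoˡ-< y c<2^K ⟩
  2 ^ K + y    ≡⟨ +-comm (2 ^ K) y ⟩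
  y + 2 ^ K    ≤⟨ *+≤-of-∣ b (2^-∣ (<⇒≤ K<1+μy)) (<2^[1+μ] y) ⟩
  2 ^ suc (μ y) ∎)
  where
  open ≤-Reasoning
  y = b * 2 ^ K
  2^K≤y : 2 ^ K ≤ y
  2^K≤y = m≤n*m (2 ^ K) b {{>-nonZero b>0}}
  y>0 : 0 < y
  y>0 = <-≤-trans (m^n>0 2 K) 2^K≤y
  K<1+μy : K < suc (μ y)
  K<1+μy = 2^-cancel-< (≤-<-trans 2^K≤y (<2^[1+μ] y))

2^-+ : ∀ K₁ d {K₂} → K₁ + d ≡ K₂ → 2 ^ K₂ ≡ 2 ^ K₁ * 2 ^ d
2^-+ K₁ d refl = ^-distribˡ-+-* 2 K₁ d

high-split : ∀ x {K₁ K₂} d → K₁ + d ≡ K₂ → high x K₁ ≡ high (low x K₂) K₁ + high x K₂ * 2 ^ d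
high-split x {K₁} {K₂} d K₁+d≡K₂ = proj₁ (high-low-unique K₁ x≡ (low<2^ y K₁))
  where
  y = low x K₂
  x≡ : x ≡ low y K₁ + (high y K₁ + high x K₂ * 2 ^ d) * 2 ^ K₁
  x≡ = begin
    x
      ≡⟨ low+highPart x K₂ ⟩
    y + high x K₂ * 2 ^ K₂
      ≡⟨ cong₂ (λ a b → a + high x K₂ * b) (low+highPart y K₁) (2^-+ K₁ d K₁+d≡K₂) ⟩
    low y K₁ + high y K₁ * 2 ^ K₁ + high x K₂ * (2 ^ K₁ * 2 ^ d)
      ≡⟨ regroup (low y K₁) (high y K₁) (high x K₂) (2 ^ K₁) (2 ^ d) ⟩
    low y K₁ + (high y K₁ + high x K₂ * 2 ^ d) * 2 ^ K₁ ∎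
    where
    open ≡-Reasoning
    regroup : ∀ l b h P D → l + b * P + h * (P * D) ≡ l + (b + h * D) * P
    regroup = solve-∀

highPart≤ : ∀ x K → highPart x K ≤ x
highPart≤ x K = subst (highPart x K ≤_) (sym (low+highPart x K)) (m≤n+m (highPart x K) (low x K))

highPart-split : ∀ x {K₁ K₂} → K₁ ≤ K₂ →
                 high (highPart x K₁) K₂ ≡ high x K₂ × low (highPart x K₁) K₂ ≡ highPart (low x K₂) K₁
highPart-split x {K₁} {K₂} K₁≤K₂ with d , K₁+d≡K₂ ← m≤n⇒∃[o]m+o≡n K₁≤K₂ =
  high-low-unique K₂ p≡ (≤-<-trans (highPart≤ y K₁) (low<2^ x K₂))
  where
  y = low x K₂
  p≡ : highPart x K₁ ≡ highPart y K₁ + high x K₂ * 2 ^ K₂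
  p≡ = begin
    high x K₁ * 2 ^ K₁
      ≡⟨ cong (_* 2 ^ K₁) (high-split x d K₁+d≡K₂) ⟩
    (high y K₁ + high x K₂ * 2 ^ d) * 2 ^ K₁
      ≡⟨ distribute (high y K₁) (high x K₂) (2 ^ K₁) (2 ^ d) ⟩
    high y K₁ * 2 ^ K₁ + high x K₂ * (2 ^ K₁ * 2 ^ d)
      ≡⟨ cong (λ v → high y K₁ * 2 ^ K₁ + high x K₂ * v) (2^-+ K₁ d K₁+d≡K₂) ⟨
    high y K₁ * 2 ^ K₁ + high x K₂ * 2 ^ K₂ ∎
    where
    open ≡-Reasoning
    distribute : ∀ b h P D → (b + h * D) * P ≡ b * P + h * (P * D)
    distribute = solve-∀

low-low : ∀ x {K₁ K₂} → K₁ ≤ K₂ → low (low x K₂) K₁ ≡ low x K₁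
low-low x {K₁} {K₂} K₁≤K₂ =
  m∣n⇒o%n%m≡o%m (2 ^ K₁) (2 ^ K₂) x {{m^n≢0 2 K₁}} {{m^n≢0 2 K₂}} (2^-∣ K₁≤K₂)

high-low-parity : ∀ x {K₁ K₂} → K₁ < K₂ → high (low x K₂) K₁ % 2 ≡ high x K₁ % 2
high-low-parity x {K₁} {K₂} K₁<K₂ with d , K₁+1+d≡K₂ ← m≤n⇒∃[o]m+o≡n K₁<K₂ = sym (begin
  high x K₁ % 2                         ≡⟨ cong (_% 2) (high-split x (suc d) (trans (+-suc K₁ d) K₁+1+d≡K₂)) ⟩
  (b + high x K₂ * 2 ^ suc d) % 2       ≡⟨ cong (_% 2) (even-tail b (high x K₂) (2 ^ d)) ⟩
  (b + high x K₂ * 2 ^ d * 2) % 2       ≡⟨ [m+kn]%n≡m%n b (high x K₂ * 2 ^ d) 2 ⟩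
  b % 2                                 ∎)
  where
  open ≡-Reasoning
  b = high (low x K₂) K₁
  even-tail : ∀ b h D → b + h * (2 * D) ≡ b + h * D * 2
  even-tail = solve-∀

μ-+-<2^λ₂ : ∀ {w q} → 0 < w → q < 2 ^ λ₂ w → μ (w + q) ≡ μ w
μ-+-<2^λ₂ {w} {q} w>0 q<2^k with u , u-odd , w≡ ← λ₂-spec w>0 = begin
  μ (w + q)           ≡⟨ cong μ (+-comm w q) ⟩
  μ (q + w)           ≡⟨ cong (λ v → μ (q + v)) w≡ ⟩
  μ (q + u * 2 ^ k)   ≡⟨ μ-+-* u k q (odd⇒pos u u-odd) q<2^k ⟩
  μ (u * 2 ^ k)       ≡⟨ cong μ w≡ ⟨
  μ w                 ∎
  where
  open ≡-Reasoning
  k = λ₂ w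

-- The potential

combine : ℤ → ℤ → ℤ → ℤ
combine a b c = a ℤ.+ 1ℤ ℤ.- b ℤ.+ c

combine-assoc : ∀ a b c d e → combine (combine a b c) d e ≡ combine a b (combine c d e)
combine-assoc = unfolded
  where
  unfolded : ∀ a b c d e → (a ℤ.+ 1ℤ ℤ.- b ℤ.+ c) ℤ.+ 1ℤ ℤ.- d ℤ.+ e
                          ≡ a ℤ.+ 1ℤ ℤ.- b ℤ.+ (c ℤ.+ 1ℤ ℤ.- d ℤ.+ e)
  unfolded = ℤ-Solver.solve-∀

combine-cancel : ∀ a b → combine a b b ≡ a ℤ.+ 1ℤ
combine-cancel = unfolded
  where
  unfolded : ∀ a b → a ℤ.+ 1ℤ ℤ.- b ℤ.+ b ≡ a ℤ.+ 1ℤ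
  unfolded = ℤ-Solver.solve-∀

module Potential (Q : ℕ → ℕ → ℕ → Maybe ℕ) (s : ℕ) where

  -- y is the label q = Q (μ y) K s with the bits of q below λ₂ y cleared.
  record Prefix (K q y : ℕ) : Set where
    field
      pos      : 0 < y
      labelled : Q (μ y) K s ≡ just q
      ≤label   : y ≤ q
      label<   : q < y + 2 ^ λ₂ y

  record Cut (x K q : ℕ) : Set where
    field
      high-odd : high x K % 2 ≡ 1
      prefix   : Prefix K q (low x K)

  prefix? : ∀ K y → Dec (∃ λ q → Prefix K q y)
  prefix? K y with Q (μ y) K s in label
  ... | nothing = no λ (_ , p) → case trans (sym label) (Prefix.labelled p) of λ ()
  ... | just q  = map′ (λ (pos , ≤q , q<) → q , record
                         { pos = pos ; labelled = label ; ≤label = ≤q ; label< = q< })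
                       (λ (_ , p) → conditions p (just-injective (trans (sym (Prefix.labelled p)) label)))
                       (0 <? y ×-dec y ≤? q ×-dec q <? y + 2 ^ λ₂ y)
    where
    conditions : ∀ {q′} → Prefix K q′ y → q′ ≡ q → 0 < y × y ≤ q × q < y + 2 ^ λ₂ y
    conditions p refl = Prefix.pos p , Prefix.≤label p , Prefix.label< p

  cut? : ∀ x K → Dec (∃ (Cut x K))
  cut? x K = map′ (λ (odd , q , p) → q , record { high-odd = odd ; prefix = p })
                  (λ (q , c) → Cut.high-odd c , q , Cut.prefix c)
                  (high x K % 2 ≟ 1 ×-dec prefix? K (low x K))

  module _ {x K q} (c : Cut x K q) where
    open Cut c
    open Prefix prefix

    2^≤-of-cut : 2 ^ K ≤ x
    2^≤-of-cut = ≤-trans (m≤n*m (2 ^ K) (high x K) {{>-nonZero (odd⇒pos _ high-odd)}}) (highPart≤ x K)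

    highPart<-of-cut : highPart x K < x
    highPart<-of-cut = subst (highPart x K <_) (sym (low+highPart x K)) (m<n+m _ pos)

    low<-of-cut : low x K < x
    low<-of-cut = <-≤-trans (low<2^ x K) 2^≤-of-cut

    label<-of-cut : q < x
    label<-of-cut = <-≤-trans label< (≤-trans (+2^λ₂≤2^ (low x K) K pos (low<2^ x K)) 2^≤-of-cut)

    level<-of-cut : K < x
    level<-of-cut = <-≤-trans (n<2^n K) 2^≤-of-cut

  private
    step : ∀ x → (∀ {y} → y < x → ℤ) → ℤ
    step x rec with anyUpTo? (cut? x) x
    ... | yes (_ , _ , _ , c) = combine (rec (highPart<-of-cut c)) (rec (label<-of-cut c)) (rec (low<-of-cut c))
    ... | no _                = 0ℤ

    step-ext : ∀ x {IH IH′ : ∀ {y} → y < x → ℤ} → (∀ {y} (y<x : y < x) → IH y<x ≡ IH′ y<x) →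
               step x IH ≡ step x IH′
    step-ext x IH≡IH′ with anyUpTo? (cut? x) x
    ... | yes (_ , _ , _ , c)
      rewrite IH≡IH′ (highPart<-of-cut c) | IH≡IH′ (label<-of-cut c) | IH≡IH′ (low<-of-cut c) = refl
    ... | no _ = refl

  Φ : ℕ → ℤ
  Φ = <-rec _ step

  cutValue : ℕ → ℕ → ℕ → ℤ
  cutValue x K q = combine (Φ (highPart x K)) (Φ q) (Φ (low x K))

  Φ-at-some-cut : ∀ {x K q} → Cut x K q → ∃₂ λ K′ q′ → Cut x K′ q′ × Φ x ≡ cutValue x K′ q′
  Φ-at-some-cut {x} c with anyUpTo? (cut? x) x | FixPoint.unfold-wfRec <-wellFounded _ step step-ext {x}
  ... | yes (K′ , _ , q′ , c′) | Φx≡ = K′ , q′ , c′ , Φx≡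
  ... | no no-cut              | _   = ⊥-elim (no-cut (_ , level<-of-cut c , _ , c))

  Prefix-highPart : ∀ {K q y} K₁ → high y K₁ % 2 ≡ 1 → 0 < low y K₁ →
                    Prefix K q y → Prefix K q (highPart y K₁)
  Prefix-highPart {K} {q} {y} K₁ b-odd l>0 p = record
    { pos      = odd*2^-pos b K₁ b-odd
    ; labelled = subst (λ n → Q n K s ≡ just q) μy≡μz labelled
    ; ≤label   = ≤-trans (highPart≤ y K₁) ≤label
    ; label<   = <-≤-trans label< y+2^λ₂y≤
    }
    where
    open Prefix p
    b = high y K₁
    l = low y K₁
    z = highPart y K₁
    l<2^K₁ = low<2^ y K₁
    μy≡μz : μ y ≡ μ z
    μy≡μz = trans (cong μ (low+highPart y K₁)) (μ-+-* b K₁ l (odd⇒pos b b-odd) l<2^K₁)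
    y+2^λ₂y≤ : y + 2 ^ λ₂ y ≤ z + 2 ^ λ₂ z
    y+2^λ₂y≤ = begin
      y + 2 ^ λ₂ y           ≡⟨ cong (λ v → v + 2 ^ λ₂ v) (low+highPart y K₁) ⟩
      l + z + 2 ^ λ₂ (l + z) ≡⟨ cong (λ k → l + z + 2 ^ k) (λ₂-+-* l K₁ b l>0 l<2^K₁) ⟩
      l + z + 2 ^ λ₂ l       ≡⟨ cong (_+ 2 ^ λ₂ l) (+-comm l z) ⟩
      z + l + 2 ^ λ₂ l       ≡⟨ +-assoc z l (2 ^ λ₂ l) ⟩
      z + (l + 2 ^ λ₂ l)     ≤⟨ +-monoʳ-≤ z (+2^λ₂≤2^ l K₁ l>0 l<2^K₁) ⟩
      z + 2 ^ K₁             ≡⟨ cong (λ k → z + 2 ^ k) (λ₂-odd*2^ b K₁ b-odd) ⟨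
      z + 2 ^ λ₂ z           ∎
      where open ≤-Reasoning

  module _ {x} (IH : ∀ {y} → y < x → ∀ {K q} → Cut y K q → Φ y ≡ cutValue y K q) where

    cutValue-swap : ∀ {K₁ K₂ q₁ q₂} → K₁ < K₂ → Cut x K₁ q₁ → Cut x K₂ q₂ →
                    cutValue x K₁ q₁ ≡ cutValue x K₂ q₂
    cutValue-swap {K₁} {K₂} {q₁} {q₂} K₁<K₂ c₁ c₂ = begin
      combine (Φ p₁) (Φ q₁) (Φ y₁)
        ≡⟨ cong (λ v → combine v (Φ q₁) (Φ y₁)) (IH (highPart<-of-cut c₁) cut-of-p₁) ⟩
      combine (combine (Φ (highPart p₁ K₂)) (Φ q₂) (Φ (low p₁ K₂))) (Φ q₁) (Φ y₁)
        ≡⟨ cong₂ (λ a b → combine (combine (Φ a) (Φ q₂) (Φ b)) (Φ q₁) (Φ y₁))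
                 (cong (_* 2 ^ K₂) high-p₁) low-p₁ ⟩
      combine (combine (Φ p₂) (Φ q₂) (Φ z)) (Φ q₁) (Φ y₁)
        ≡⟨ combine-assoc (Φ p₂) (Φ q₂) (Φ z) (Φ q₁) (Φ y₁) ⟩
      combine (Φ p₂) (Φ q₂) (combine (Φ z) (Φ q₁) (Φ y₁))
        ≡⟨ cong (λ v → combine (Φ p₂) (Φ q₂) (combine (Φ z) (Φ q₁) (Φ v))) low-y₂ ⟨
      combine (Φ p₂) (Φ q₂) (cutValue y₂ K₁ q₁)
        ≡⟨ cong (combine (Φ p₂) (Φ q₂)) (IH (low<-of-cut c₂) cut-of-y₂) ⟨
      combine (Φ p₂) (Φ q₂) (Φ y₂) ∎
      where
      open ≡-Reasoning
      p₁ = highPart x K₁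
      p₂ = highPart x K₂
      y₁ = low x K₁
      y₂ = low x K₂
      z  = highPart y₂ K₁
      high-p₁ = proj₁ (highPart-split x (<⇒≤ K₁<K₂))
      low-p₁  = proj₂ (highPart-split x (<⇒≤ K₁<K₂))
      low-y₂  = low-low x (<⇒≤ K₁<K₂)
      y₂-odd : high y₂ K₁ % 2 ≡ 1
      y₂-odd = trans (high-low-parity x K₁<K₂) (Cut.high-odd c₁)
      y₂-low-pos : 0 < low y₂ K₁
      y₂-low-pos = subst (0 <_) (sym low-y₂) (Prefix.pos (Cut.prefix c₁))
      cut-of-y₂ : Cut y₂ K₁ q₁
      cut-of-y₂ = record { high-odd = y₂-odd ; prefix = subst (Prefix K₁ q₁) (sym low-y₂) (Cut.prefix c₁) }
      cut-of-p₁ : Cut p₁ K₂ q₂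
      cut-of-p₁ = record
        { high-odd = trans (cong (_% 2) high-p₁) (Cut.high-odd c₂)
        ; prefix   = subst (Prefix K₂ q₂) (sym low-p₁) (Prefix-highPart K₁ y₂-odd y₂-low-pos (Cut.prefix c₂))
        }

    cutValue-unique : ∀ {K K′ q q′} → Cut x K q → Cut x K′ q′ → cutValue x K q ≡ cutValue x K′ q′
    cutValue-unique {K} {K′} c c′ with <-cmp K K′
    ... | tri< K<K′ _ _ = cutValue-swap K<K′ c c′
    ... | tri> _ _ K′<K = sym (cutValue-swap K′<K c′ c)
    ... | tri≈ _ refl _ = cong (cutValue x K) (just-injective (trans (sym (label c)) (label c′)))
      where
      label : ∀ {q} → Cut x K q → Q (μ (low x K)) K s ≡ just q
      label c = Prefix.labelled (Cut.prefix c)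

  Φ-cut : ∀ x {K q} → Cut x K q → Φ x ≡ cutValue x K q
  Φ-cut = <-rec _ λ x IH {_} {_} c →
    let (_ , _ , c′ , Φx≡) = Φ-at-some-cut c in trans Φx≡ (cutValue-unique IH c′ c)

  Φ-edge : ∀ {w q} → 0 < w → 0 < q → q < 2 ^ λ₂ w → Q (μ q) (λ₂ w) s ≡ just q →
           Φ (w + q) ≡ Φ w ℤ.+ 1ℤ
  Φ-edge {w} {q} w>0 q>0 q<2^k labelled with u , u-odd , w≡ ← λ₂-spec w>0 = begin
    Φ (w + q)
      ≡⟨ Φ-cut (w + q) edge-cut ⟩
    combine (Φ (highPart (w + q) k)) (Φ q) (Φ (low (w + q) k))
      ≡⟨ cong₂ (λ a b → combine (Φ a) (Φ q) (Φ b)) highPart≡w low≡q ⟩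
    combine (Φ w) (Φ q) (Φ q)
      ≡⟨ combine-cancel (Φ w) (Φ q) ⟩
    Φ w ℤ.+ 1ℤ ∎
    where
    open ≡-Reasoning
    k = λ₂ w
    split : high (w + q) k ≡ u × low (w + q) k ≡ q
    split = high-low-unique k (trans (+-comm w q) (cong (q +_) w≡)) q<2^k
    low≡q : low (w + q) k ≡ q
    low≡q = proj₂ split
    highPart≡w : highPart (w + q) k ≡ w
    highPart≡w = trans (cong (_* 2 ^ k) (proj₁ split)) (sym w≡)
    edge-cut : Cut (w + q) k q
    edge-cut = record
      { high-odd = trans (cong (_% 2) (proj₁ split)) u-odd
      ; prefix   = subst (Prefix k q) (sym low≡q) (record
          { pos = q>0 ; labelled = labelled ; ≤label = ≤-refl ; label< = m<m+n q (m^n>0 2 (λ₂ q)) })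
      }

mainTheorem8 : (Q : ℕ → ℕ → ℕ → Maybe ℕ)
    → (∀ n k s x → Q n k s ≡ just x → B n x)
    → (r : ℕ) → .{{_ : NonZero r}} → 1 < r
    → Σ (ℕ → Fin r) λ c →
        ∀ (w : ℕ) → 0 < w → ∀ (n : ℕ) → n < λ₂ w → ∀ (q : ℕ)
        → Q n (λ₂ w) (μ w) ≡ just q
        → toℕ (c (w + q)) ≡ (toℕ (c w) + 1) % r
mainTheorem8 Q Q∈B r _ = colour , colour-step
  where
  Φ : ℕ → ℕ → ℤ
  Φ s = Potential.Φ Q s

  colour : ℕ → Fin r
  colour x = fromℕ< (n%ℕd<d (Φ (μ x) x) r)

  colour-step : ∀ w → 0 < w → ∀ n → n < λ₂ w → ∀ q → Q n (λ₂ w) (μ w) ≡ just q →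
                toℕ (colour (w + q)) ≡ (toℕ (colour w) + 1) % r
  colour-step w w>0 n n<λ₂w q labelled = begin
    toℕ (colour (w + q))        ≡⟨ toℕ-fromℕ< _ ⟩
    Φ (μ (w + q)) (w + q) %ℕ r  ≡⟨ cong (λ s → Φ s (w + q) %ℕ r) (μ-+-<2^λ₂ w>0 q<2^λ₂w) ⟩
    Φ (μ w) (w + q) %ℕ r        ≡⟨ cong (_%ℕ r) (Potential.Φ-edge Q (μ w) w>0 q>0 q<2^λ₂w labelled′) ⟩
    (Φ (μ w) w ℤ.+ 1ℤ) %ℕ r     ≡⟨ [i+1]%ℕd (Φ (μ w) w) r ⟩
    (Φ (μ w) w %ℕ r + 1) % r    ≡⟨ cong (λ v → (v + 1) % r) (toℕ-fromℕ< _) ⟨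
    (toℕ (colour w) + 1) % r    ∎
    where
    open ≡-Reasoning
    q∈Bⁿ = Q∈B n (λ₂ w) (μ w) q labelled
    q>0 = proj₁ q∈Bⁿ
    labelled′ : Q (μ q) (λ₂ w) (μ w) ≡ just q
    labelled′ = subst (λ m → Q m (λ₂ w) (μ w) ≡ just q) (sym (proj₂ q∈Bⁿ)) labelled
    q<2^λ₂w : q < 2 ^ λ₂ w
    q<2^λ₂w = <-≤-trans (<2^[1+μ] q) (^-monoʳ-≤ 2 (subst (_< λ₂ w) (sym (proj₂ q∈Bⁿ)) n<λ₂w))
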